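{- Let $n,N>0$ be integers. If $n\le N$ then $\alpha_3(n,N)\le \overline{\alpha}(n,N)$. If $N\ge 2n-1$, then $\alpha_3(n,N)=\overline{\alpha}(n,N)$.
   Context: $[n]=\{1,\dots,n\}$. A line in $[n]^2\times[N]$ is a set obtained by fixing two of the three coordinates and letting the remaining one vary over its whole range. A linjection $f:[n]^2\times[N]\to\{0,1\}$ (with $N\ge n$) is a function such that for every $(x,y)\in[n]^2$ there is exactly one $b\in[N]$ with $f(x,y,b)=1$, and every line contains at most one point at which $f=1$. (Equivalently, $f$ is encoded by an $n\times n$ matrix $A$ with entries in $[N]$, $A(x,y)=b\iff f(x,y,b)=1$, with no repeated value in any row or column.) In $X_1\times X_2\times X_3=[n]\times[n]\times[N]$, a cylinder in dimension $i$ is a subset closed under arbitrary changes of the $i$-th coordinate, and a cylinder intersection is a set $T_1\cap T_2\cap T_3$ with $T_i$ a cylinder in dimension $i$. $\alpha_3(f)$ is the largest cardinality of a cylinder intersection contained in $f^{ -1}(1)$, and $\alpha_3(n,N)=\max_f \alpha_3(f)$ over all linjections $f:[n]^2\times[N]\to\{0,1\}$. For a subgraph $G$ of the complete tripartite graph $K_{n,n,N}$, $\overline{\alpha}(G)$ is the largest cardinality of a family of pairwise edge-disjoint triangles in $G$ such that the graph formed by the union of the triangles in the family contains no triangle other than those of the family. $\overline{\alpha}(n,N)=\max_G\overline{\alpha}(G)$ over all subgraphs $G$ of $K_{n,n,N}$. -}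

module Defs where

open import Data.Bool.Base using (true; false)
open import Data.Fin.Base using (Fin; zero; suc; combine; _↑ˡ_; _↑ʳ_)
open import Data.Fin.Properties using (_≟_; any?; all?)
open import Data.Fin.Subset using (Subset; inside; outside; _∩_; _⊆_; ∣_∣)
  renaming (_∈_ to _∈ₛ_)
open import Data.Fin.Subset.Properties using (anySubset?; _⊆?_)
  renaming (_∈?_ to _∈ₛ?_)
open import Data.List.Base using (List; []; _∷_; map; filter; cartesianProductWith)
open import Data.List.Extrema.Nat using (max; xs≤max; max≤v⁺)
open import Data.List.Membership.Propositional using () renaming (_∈_ to _∈ₗ_)
open import Data.List.Membership.Propositional.Properties
  using (∈-cartesianProductWith⁺; ∈-map⁺; ∈-map⁻; ∈-filter⁺; ∈-filter⁻)
import Data.List.Relation.Unary.All as All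
open import Data.List.Relation.Unary.Any using (here; there)
open import Data.Nat.Base using (ℕ; zero; suc; _+_; _*_; _≤_; z≤n)
open import Data.Product using (∃; ∃!; _×_; _,_; proj₂)
open import Data.Product.Properties using (≡-dec)
open import Data.Sum.Base using (_⊎_)
open import Data.Unit.Base using (⊤; tt)
open import Data.Vec.Base using ([]; _∷_)
import Data.Vec.Properties as Vec
import Data.Bool.Properties as Bool
open import Level using (0ℓ)
open import Relation.Binary.Definitions using (DecidableEquality)
open import Relation.Binary.PropositionalEquality using (_≡_; _≢_; refl)
open import Relation.Nullary using (Dec; yes; ¬_; ¬?)
open import Relation.Nullary.Decidable using (map′; _×-dec_; _⊎-dec_; _→-dec_)
open import Relation.Unary using (Pred; Decidable)

subsets : ∀ m → List (Subset m)
subsets zero    = [] ∷ []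
subsets (suc m) = cartesianProductWith _∷_ (outside ∷ inside ∷ []) (subsets m)

-- By convention the maximum is 0 when no subset satisfies P.
maxOver : ∀ {m} {P : Pred (Subset m) 0ℓ} → Decidable P → (Subset m → ℕ) → ℕ
maxOver P? h = max 0 (map h (filter P? (subsets _)))

∈-subsets : ∀ {m} (S : Subset m) → S ∈ₗ subsets m
∈-subsets []          = here refl
∈-subsets (false ∷ S) = ∈-cartesianProductWith⁺ _∷_ {xs = outside ∷ inside ∷ []} (here refl) (∈-subsets S)
∈-subsets (true ∷ S)  = ∈-cartesianProductWith⁺ _∷_ {xs = outside ∷ inside ∷ []} (there (here refl)) (∈-subsets S)

maxOver-upper : ∀ {m} {P : Pred (Subset m) 0ℓ} (P? : Decidable P) h {S} →
                P S → h S ≤ maxOver P? h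
maxOver-upper P? h {S} PS =
  All.lookup (xs≤max 0 _) (∈-map⁺ h (∈-filter⁺ P? (∈-subsets S) PS))

maxOver-least : ∀ {m} {P : Pred (Subset m) 0ℓ} (P? : Decidable P) h {k} →
                (∀ S → P S → h S ≤ k) → maxOver P? h ≤ k
maxOver-least {m} P? h {k} bound = max≤v⁺ z≤n (All.tabulate below)
  where
  below : ∀ {v} → v ∈ₗ map h (filter P? (subsets m)) → v ≤ k
  below v∈ with ∈-map⁻ h v∈
  ... | S , S∈ , refl = bound S (proj₂ (∈-filter⁻ P? {xs = subsets m} S∈))

module Box (n N : ℕ) where

  Point : Set
  Point = Fin n × Fin n × Fin N

  _≟ₚ_ : DecidableEquality Point
  _≟ₚ_ = ≡-dec _≟_ (≡-dec _≟_ _≟_)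

  allPoints? : ∀ {P : Pred Point 0ℓ} → Decidable P → Dec (∀ p → P p)
  allPoints? P? =
    map′ (λ ∀P (x , y , z) → ∀P x y z) (λ ∀P x y z → ∀P (x , y , z))
      (all? λ x → all? λ y → all? λ z → P? (x , y , z))

  anyPoint? : ∀ {P : Pred Point 0ℓ} → Decidable P → Dec (∃ P)
  anyPoint? P? =
    map′ (λ (x , y , z , Pxyz) → (x , y , z) , Pxyz)
         (λ ((x , y , z) , Pxyz) → x , y , z , Pxyz)
      (any? λ x → any? λ y → any? λ z → P? (x , y , z))

  -- Sets of points, and equivalently {0,1}-valued functions on points
  -- (represented by the set of points at which the value is 1).
  Points : Set
  Points = Subset (n * (n * N))

  index : Point → Fin (n * (n * N))
  index (x , y , z) = combine x (combine y z)

  infix 4 _∈_ _∈?_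

  _∈_ : Point → Points → Set
  p ∈ S = index p ∈ₛ S

  _∈?_ : ∀ p S → Dec (p ∈ S)
  p ∈? S = index p ∈ₛ? S

  -- p and q differ at most in the i-th coordinate; equivalently, they lie on
  -- a common line in direction i.
  AgreeOff : Fin 3 → Point → Point → Set
  AgreeOff zero             (x , y , z) (x′ , y′ , z′) = y ≡ y′ × z ≡ z′
  AgreeOff (suc zero)       (x , y , z) (x′ , y′ , z′) = x ≡ x′ × z ≡ z′
  AgreeOff (suc (suc zero)) (x , y , z) (x′ , y′ , z′) = x ≡ x′ × y ≡ y′

  agreeOff? : ∀ i p q → Dec (AgreeOff i p q)
  agreeOff? zero             (x , y , z) (x′ , y′ , z′) = y ≟ y′ ×-dec z ≟ z′
  agreeOff? (suc zero)       (x , y , z) (x′ , y′ , z′) = x ≟ x′ ×-dec z ≟ z′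
  agreeOff? (suc (suc zero)) (x , y , z) (x′ , y′ , z′) = x ≟ x′ ×-dec y ≟ y′

  LinesContainAtMostOne : Points → Set
  LinesContainAtMostOne f =
    ∀ i p q → AgreeOff i p q → p ∈ f → q ∈ f → p ≡ q

  IsLinjection : Points → Set
  IsLinjection f =
    (∀ x y → ∃! _≡_ λ b → (x , y , b) ∈ f) × LinesContainAtMostOne f

  isLinjection? : Decidable IsLinjection
  isLinjection? f =
    (all? λ x → all? λ y → any? λ b →
       (x , y , b) ∈? f ×-dec
       map′ (λ u {b′} → u b′) (λ u b′ → u {b′})
         (all? λ b′ → (x , y , b′) ∈? f →-dec b ≟ b′))
    ×-dec
    (all? λ i → allPoints? λ p → allPoints? λ q →
       agreeOff? i p q →-dec (p ∈? f →-dec (q ∈? f →-dec p ≟ₚ q)))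

  IsCylinder : Fin 3 → Points → Set
  IsCylinder i T = ∀ p q → AgreeOff i p q → p ∈ T → q ∈ T

  isCylinder? : ∀ i → Decidable (IsCylinder i)
  isCylinder? i T = allPoints? λ p → allPoints? λ q →
    agreeOff? i p q →-dec (p ∈? T →-dec q ∈? T)

  IsCylinderIntersection : Points → Set
  IsCylinderIntersection S = ∃ λ T₁ → ∃ λ T₂ → ∃ λ T₃ →
    IsCylinder zero T₁ × IsCylinder (suc zero) T₂ × IsCylinder (suc (suc zero)) T₃ ×
    S ≡ T₁ ∩ T₂ ∩ T₃

  isCylinderIntersection? : Decidable IsCylinderIntersection
  isCylinderIntersection? S =
    anySubset? λ T₁ → anySubset? λ T₂ → anySubset? λ T₃ →
      isCylinder? zero T₁ ×-dec isCylinder? (suc zero) T₂ ×-dec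
      isCylinder? (suc (suc zero)) T₃ ×-dec
      Vec.≡-dec Bool._≟_ S (T₁ ∩ T₂ ∩ T₃)

  α₃-of : Points → ℕ
  α₃-of f = maxOver (λ S → isCylinderIntersection? S ×-dec S ⊆? f) ∣_∣

  -- The edges of K_{n,n,N}, with parts Fin n, Fin n and Fin N: one block of
  -- indices for each pair of parts.
  Edge : Set
  Edge = Fin (n * n + (n * N + n * N))

  edge₁₂ : Fin n → Fin n → Edge
  edge₁₂ x y = combine x y ↑ˡ (n * N + n * N)

  edge₁₃ : Fin n → Fin N → Edge
  edge₁₃ x z = n * n ↑ʳ (combine x z ↑ˡ n * N)

  edge₂₃ : Fin n → Fin N → Edge
  edge₂₃ y z = n * n ↑ʳ (n * N ↑ʳ combine y z)

  -- Subgraphs are given by their edge sets: isolated vertices play no role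
  -- for triangles.
  Graph : Set
  Graph = Subset (n * n + (n * N + n * N))

  -- A triangle has one vertex in each part, so triangles are triples (x , y , z)
  -- and families of triangles are elements of Points.
  IsEdgeOf : Edge → Point → Set
  IsEdgeOf e (x , y , z) = e ≡ edge₁₂ x y ⊎ e ≡ edge₁₃ x z ⊎ e ≡ edge₂₃ y z

  isEdgeOf? : ∀ e p → Dec (IsEdgeOf e p)
  isEdgeOf? e (x , y , z) =
    e ≟ edge₁₂ x y ⊎-dec e ≟ edge₁₃ x z ⊎-dec e ≟ edge₂₃ y z

  IsTriangleIn : Pred Edge 0ℓ → Point → Set
  IsTriangleIn E (x , y , z) = E (edge₁₂ x y) × E (edge₁₃ x z) × E (edge₂₃ y z)

  isTriangleIn? : ∀ {E} → Decidable E → Decidable (IsTriangleIn E)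
  isTriangleIn? E? (x , y , z) =
    E? (edge₁₂ x y) ×-dec E? (edge₁₃ x z) ×-dec E? (edge₂₃ y z)

  PairwiseEdgeDisjoint : Points → Set
  PairwiseEdgeDisjoint F = ∀ p q → p ∈ F → q ∈ F → p ≢ q →
    ∀ e → ¬ (IsEdgeOf e p × IsEdgeOf e q)

  pairwiseEdgeDisjoint? : Decidable PairwiseEdgeDisjoint
  pairwiseEdgeDisjoint? F = allPoints? λ p → allPoints? λ q →
    p ∈? F →-dec (q ∈? F →-dec (¬? (p ≟ₚ q) →-dec
      all? λ e → ¬? (isEdgeOf? e p ×-dec isEdgeOf? e q)))

  UnionGraph : Points → Pred Edge 0ℓ
  UnionGraph F e = ∃ λ p → p ∈ F × IsEdgeOf e p

  unionGraph? : ∀ F → Decidable (UnionGraph F)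
  unionGraph? F e = anyPoint? λ p → p ∈? F ×-dec isEdgeOf? e p

  IsAdmissible : Graph → Points → Set
  IsAdmissible G F =
    (∀ p → p ∈ F → IsTriangleIn (_∈ₛ G) p) ×
    PairwiseEdgeDisjoint F ×
    (∀ p → IsTriangleIn (UnionGraph F) p → p ∈ F)

  isAdmissible? : ∀ G → Decidable (IsAdmissible G)
  isAdmissible? G F =
    (allPoints? λ p → p ∈? F →-dec isTriangleIn? (_∈ₛ? G) p) ×-dec
    pairwiseEdgeDisjoint? F ×-dec
    (allPoints? λ p → isTriangleIn? (unionGraph? F) p →-dec p ∈? F)

  ᾱ-of : Graph → ℕ
  ᾱ-of G = maxOver (isAdmissible? G) ∣_∣

-- Linjections exist only when n ≤ N; otherwise α₃ n N is 0 by convention.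
α₃ : ℕ → ℕ → ℕ
α₃ n N = maxOver isLinjection? α₃-of
  where open Box n N

ᾱ : ℕ → ℕ → ℕ
ᾱ n N = maxOver {P = λ _ → ⊤} (λ _ → yes tt) ᾱ-of
  where open Box n N

{-# OPTIONS --safe #-}

-- Two triangles share an edge exactly when, as points of the box, they lie on
-- a common line. Hence a family of triangles is edge-disjoint iff every line
-- meets it at most once, and its union contains no further triangle iff the
-- family is a cylinder intersection (of the cylinders it generates). This
-- turns a cylinder intersection inside a linjection into an admissible family
-- of the complete graph. Conversely an admissible family is a partial matrix
-- without repetition in rows and columns; when N ≥ 2n − 1 its empty cells can
-- be filled greedily, as at most 2(n − 1) values are forbidden in each cell.
module Submission where

open import Defs using (α₃; ᾱ; maxOver-upper; maxOver-least; module Box)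
open import Data.Empty using (⊥-elim)
open import Data.Fin.Base using (Fin; zero; suc; combine; splitAt; join; punchOut; _↑ˡ_; _↑ʳ_)
open import Data.Fin.Properties
  using (_≟_; any?; injective⇒≤; combine-injective; combine-surjective;
         splitAt-↑ˡ; splitAt-↑ʳ; splitAt-join; ↑ˡ-injective; ↑ʳ-injective; punchOut-injective)
open import Data.Fin.Subset using (Subset; ⊤; ⁅_⁆; _∩_; _∪_; _⊆_)
  renaming (_∈_ to _∈ₛ_)
open import Data.Fin.Subset.Properties
  using (∈⊤; x∈⁅x⁆; x∈⁅y⁆⇒x≡y; x∈p∩q⁺; x∈p∩q⁻; x∈p∪q⁻; p⊆p∪q; q⊆p∪q; ⊆-antisym; _⊆?_)
open import Data.List.Base using ([]; _∷_; allFin; cartesianProduct)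
open import Data.List.Membership.Propositional.Properties using (∈-allFin; ∈-cartesianProduct⁺)
open import Data.List.Relation.Unary.All using (All; []; _∷_; lookup)
open import Data.Nat.Base using (ℕ; suc; _+_; _≤_; _≥_; _>_; _*_; _∸_)
open import Data.Nat.Properties using (≤-antisym; ≤-trans; <-irrefl; +-suc; +-identityʳ)
open import Data.Product.Base using (∃; _×_; _,_; proj₁; proj₂)
open import Data.Sum.Base using (_⊎_; inj₁; inj₂)
open import Data.Sum.Properties using (inj₁-injective; inj₂-injective)
open import Data.Unit.Base using (tt)
open import Data.Vec.Base using (tabulate)
open import Data.Vec.Properties using (lookup∘tabulate; lookup⇒[]=; []=⇒lookup)
open import Function.Base using (_∘_)
open import Function.Definitions using (Injective)
open import Level using (0ℓ)
open import Relation.Binary.PropositionalEquality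
  using (_≡_; _≢_; refl; sym; trans; cong; subst)
open import Relation.Nullary using (¬_; yes; no; does; ¬?)
open import Relation.Nullary.Decidable
  using (dec-true; decidable-stable; _×-dec_; _⊎-dec_)
open import Relation.Unary using (Pred; Decidable)

-- Finite subsets and a counting bound

private
  variable
    k m n N : ℕ

comprehension : {P : Pred (Fin m) 0ℓ} → Decidable P → Subset m
comprehension P? = tabulate (does ∘ P?)

∈-comprehension⁺ : {P : Pred (Fin m) 0ℓ} (P? : Decidable P) → ∀ {i} → P i → i ∈ₛ comprehension P?
∈-comprehension⁺ P? {i} Pi =
  lookup⇒[]= i _ (trans (lookup∘tabulate _ i) (dec-true (P? i) Pi))

∈-comprehension⁻ : {P : Pred (Fin m) 0ℓ} (P? : Decidable P) → ∀ {i} → i ∈ₛ comprehension P? → P i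
∈-comprehension⁻ P? {i} i∈ with P? i | trans (sym (lookup∘tabulate (does ∘ P?) i)) ([]=⇒lookup i∈)
-- In the `no` case the abstracted equation would read `false ≡ true`, so only this clause remains.
... | yes Pi | _ = Pi

↑ˡ≢↑ʳ : ∀ (i : Fin m) (j : Fin n) → i ↑ˡ n ≢ m ↑ʳ j
↑ˡ≢↑ʳ {m} {n} i j eq
  with () ← trans (sym (splitAt-↑ˡ m i n)) (trans (cong (splitAt m) eq) (splitAt-↑ʳ m n j))

join-injective : ∀ m n → Injective _≡_ _≡_ (join m n)
join-injective m n {a} {b} eq =
  trans (sym (splitAt-join m n a)) (trans (cong (splitAt m) eq) (splitAt-join m n b))

module _ {R : Fin (suc k) → Fin N → Set} {S : Fin (suc m) → Fin N → Set} where

  -- Omitting i₀ and j₀ leaves k + m indices, each serving at most one value.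
  covered⇒≤ : ∀ i₀ j₀ → (∀ b → ¬ R i₀ b) → (∀ b → ¬ S j₀ b) →
              (∀ {i b b′} → R i b → R i b′ → b ≡ b′) →
              (∀ {j b b′} → S j b → S j b′ → b ≡ b′) →
              (∀ b → (∃ λ i → R i b) ⊎ (∃ λ j → S j b)) → N ≤ k + m
  covered⇒≤ i₀ j₀ ¬R₀ ¬S₀ R-unique S-unique cover =
    injective⇒≤ {f = λ b → join k m (code (cover b))}
      (λ {b} {b′} eq → code-injective (cover b) (cover b′) (join-injective k m eq))
    where
    avoidsR : ∀ {i b} → R i b → i₀ ≢ i
    avoidsR r refl = ¬R₀ _ r

    avoidsS : ∀ {j b} → S j b → j₀ ≢ j
    avoidsS s refl = ¬S₀ _ s

    code : ∀ {b} → (∃ λ i → R i b) ⊎ (∃ λ j → S j b) → Fin k ⊎ Fin m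
    code (inj₁ (i , r)) = inj₁ (punchOut (avoidsR r))
    code (inj₂ (j , s)) = inj₂ (punchOut (avoidsS s))

    code-injective : ∀ {b b′} (c : (∃ λ i → R i b) ⊎ (∃ λ j → S j b))
                     (c′ : (∃ λ i → R i b′) ⊎ (∃ λ j → S j b′)) → code c ≡ code c′ → b ≡ b′
    code-injective (inj₁ (i , r)) (inj₁ (i′ , r′)) eq
      with refl ← punchOut-injective (avoidsR r) (avoidsR r′) (inj₁-injective eq) = R-unique r r′
    code-injective (inj₂ (j , s)) (inj₂ (j′ , s′)) eq
      with refl ← punchOut-injective (avoidsS s) (avoidsS s′) (inj₂-injective eq) = S-unique s s′
    code-injective (inj₁ _) (inj₂ _) ()
    code-injective (inj₂ _) (inj₁ _) ()

-- Lines, shadows and cylinder intersections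

module BoxProperties (n N : ℕ) where
  open Box n N

  index-injective : ∀ {p q} → index p ≡ index q → p ≡ q
  index-injective {x , y , z} {x′ , y′ , z′} eq
    with refl , eq′ ← combine-injective x (combine y z) x′ (combine y′ z′) eq
    with refl , refl ← combine-injective y z y′ z′ eq′ = refl

  index-surjective : ∀ i → ∃ λ p → index p ≡ i
  index-surjective i
    with x , j , refl ← combine-surjective {n} {n * N} i
    with y , z , refl ← combine-surjective {n} {N} j = (x , y , z) , refl

  ⊆⁺ : ∀ {S T : Points} → (∀ p → p ∈ S → p ∈ T) → S ⊆ T
  ⊆⁺ S⊆T {i} i∈S with p , refl ← index-surjective i = S⊆T p i∈S

  agreeOff-sym : ∀ i {p q} → AgreeOff i p q → AgreeOff i q p
  agreeOff-sym zero             (a , b) = sym a , sym b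
  agreeOff-sym (suc zero)       (a , b) = sym a , sym b
  agreeOff-sym (suc (suc zero)) (a , b) = sym a , sym b

  agreeOff-trans : ∀ i {p q r} → AgreeOff i p q → AgreeOff i q r → AgreeOff i p r
  agreeOff-trans zero             (a , b) (c , d) = trans a c , trans b d
  agreeOff-trans (suc zero)       (a , b) (c , d) = trans a c , trans b d
  agreeOff-trans (suc (suc zero)) (a , b) (c , d) = trans a c , trans b d

  agreeOff-refl : ∀ i {p} → AgreeOff i p p
  agreeOff-refl zero             = refl , refl
  agreeOff-refl (suc zero)       = refl , refl
  agreeOff-refl (suc (suc zero)) = refl , refl

  -- The smallest cylinder in dimension `i` containing `F`, as a predicate.
  Shadow : Fin 3 → Points → Pred Point 0ℓ
  Shadow i F p = ∃ λ q → q ∈ F × AgreeOff i q p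

  -- The star criterion for cylinder intersections: three points of `F`, one on each line through
  -- `p`, form a star with centre `p`, and `F` must contain the centre of each of its stars.
  ShadowClosed : Points → Set
  ShadowClosed F = ∀ p → (∀ i → Shadow i F p) → p ∈ F

  -- Each `Tᵢ` contains the witness of the `i`-th shadow, and closure in direction `i` carries it to
  -- `p`.
  cylinderIntersection⇒shadowClosed : ∀ {S} → IsCylinderIntersection S → ShadowClosed S
  cylinderIntersection⇒shadowClosed (T₁ , T₂ , T₃ , cyl₁ , cyl₂ , cyl₃ , refl) p shadow
    with q₁ , q₁∈ , a₁ ← shadow zero
       | q₂ , q₂∈ , a₂ ← shadow (suc zero)
       | q₃ , q₃∈ , a₃ ← shadow (suc (suc zero)) =
    x∈p∩q⁺ (cyl₁ q₁ p a₁ (proj₁ (x∈p∩q⁻ T₁ _ q₁∈)) ,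
    x∈p∩q⁺ (cyl₂ q₂ p a₂ (proj₁ (x∈p∩q⁻ T₂ T₃ (proj₂ (x∈p∩q⁻ T₁ _ q₂∈)))) ,
            cyl₃ q₃ p a₃ (proj₂ (x∈p∩q⁻ T₂ T₃ (proj₂ (x∈p∩q⁻ T₁ _ q₃∈))))))

  module _ (F : Points) where

    -- Subsets are indexed by `Fin`, so the shadow is transported along `index`; quantifying over
    -- `p` avoids an explicit decoding function.
    InGeneratedCylinder : Fin 3 → Pred (Fin (n * (n * N))) 0ℓ
    InGeneratedCylinder i j = ∃ λ p → index p ≡ j × Shadow i F p

    inGeneratedCylinder? : ∀ i → Decidable (InGeneratedCylinder i)
    inGeneratedCylinder? i j = anyPoint? λ p → index p ≟ j ×-dec
      anyPoint? λ q → q ∈? F ×-dec agreeOff? i q p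

    generatedCylinder : Fin 3 → Points
    generatedCylinder i = comprehension (inGeneratedCylinder? i)

    shadow⇒∈cylinder : ∀ i {p} → Shadow i F p → p ∈ generatedCylinder i
    shadow⇒∈cylinder i s = ∈-comprehension⁺ (inGeneratedCylinder? i) (_ , refl , s)

    ∈cylinder⇒shadow : ∀ i {p} → p ∈ generatedCylinder i → Shadow i F p
    ∈cylinder⇒shadow i p∈ with ∈-comprehension⁻ (inGeneratedCylinder? i) p∈
    ... | q , eq , s = subst (Shadow i F) (index-injective eq) s

    generatedCylinder-isCylinder : ∀ i → IsCylinder i (generatedCylinder i)
    generatedCylinder-isCylinder i p q p~q p∈ with ∈cylinder⇒shadow i p∈
    ... | r , r∈F , r~p = shadow⇒∈cylinder i (r , r∈F , agreeOff-trans i r~p p~q)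

  -- The generated cylinders suffice: a point in all three of them lies in all three shadows of `F`,
  -- hence in `F`.
  shadowClosed⇒cylinderIntersection : ∀ {F} → ShadowClosed F → IsCylinderIntersection F
  shadowClosed⇒cylinderIntersection {F} closed =
    T zero , T (suc zero) , T (suc (suc zero)) ,
    cyl zero , cyl (suc zero) , cyl (suc (suc zero)) ,
    ⊆-antisym (⊆⁺ λ p p∈F → x∈p∩q⁺ (F⊆T zero p∈F , x∈p∩q⁺ (F⊆T (suc zero) p∈F , F⊆T (suc (suc zero)) p∈F)))
              (⊆⁺ λ p p∈ → closed p (shadows p∈))
    where
    T = generatedCylinder F
    cyl = generatedCylinder-isCylinder F

    F⊆T : ∀ i {p} → p ∈ F → p ∈ T i
    F⊆T i {p} p∈F = shadow⇒∈cylinder F i (p , p∈F , agreeOff-refl i)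

    shadows : ∀ {p} → p ∈ T zero ∩ T (suc zero) ∩ T (suc (suc zero)) → ∀ i → Shadow i F p
    shadows {p} p∈ i with p∈T₁ , p∈T₂₃ ← x∈p∩q⁻ (T zero) _ p∈
      with p∈T₂ , p∈T₃ ← x∈p∩q⁻ (T (suc zero)) _ p∈T₂₃ = ∈cylinder⇒shadow F i (p∈T i)
      where
      p∈T : ∀ i → p ∈ T i
      p∈T zero             = p∈T₁
      p∈T (suc zero)       = p∈T₂
      p∈T (suc (suc zero)) = p∈T₃

  -- Edges of triangles as lines of the box

  edgeOff : Fin 3 → Point → Edge
  edgeOff zero             (x , y , z) = edge₂₃ y z
  edgeOff (suc zero)       (x , y , z) = edge₁₃ x z
  edgeOff (suc (suc zero)) (x , y , z) = edge₁₂ x y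

  edgeOff-isEdge : ∀ i p → IsEdgeOf (edgeOff i p) p
  edgeOff-isEdge zero             p = inj₂ (inj₂ refl)
  edgeOff-isEdge (suc zero)       p = inj₂ (inj₁ refl)
  edgeOff-isEdge (suc (suc zero)) p = inj₁ refl

  isEdge⇒edgeOff : ∀ {e p} → IsEdgeOf e p → ∃ λ i → e ≡ edgeOff i p
  isEdge⇒edgeOff (inj₁ eq)        = suc (suc zero) , eq
  isEdge⇒edgeOff (inj₂ (inj₁ eq)) = suc zero , eq
  isEdge⇒edgeOff (inj₂ (inj₂ eq)) = zero , eq

  agreeOff⇒edgeOff≡ : ∀ i {p q} → AgreeOff i p q → edgeOff i p ≡ edgeOff i q
  agreeOff⇒edgeOff≡ zero             (refl , refl) = refl
  agreeOff⇒edgeOff≡ (suc zero)       (refl , refl) = refl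
  agreeOff⇒edgeOff≡ (suc (suc zero)) (refl , refl) = refl

  edge₁₂≢edge₁₃ : ∀ {x y x′ z′} → edge₁₂ x y ≢ edge₁₃ x′ z′
  edge₁₂≢edge₁₃ = ↑ˡ≢↑ʳ _ _

  edge₁₂≢edge₂₃ : ∀ {x y y′ z′} → edge₁₂ x y ≢ edge₂₃ y′ z′
  edge₁₂≢edge₂₃ = ↑ˡ≢↑ʳ _ _

  edge₁₃≢edge₂₃ : ∀ {x z y′ z′} → edge₁₃ x z ≢ edge₂₃ y′ z′
  edge₁₃≢edge₂₃ eq = ↑ˡ≢↑ʳ _ _ (↑ʳ-injective (n * n) _ _ eq)

  -- `edgeOff i p` is the edge opposite the vertex of `p` in part `i`. The three blocks of `Edge`
  -- are disjoint, so the edge determines `i`; within a block it encodes exactly the two coordinates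
  -- kept by `AgreeOff i`.
  edgeOff-injective : ∀ i j {p q} → edgeOff i p ≡ edgeOff j q → i ≡ j × AgreeOff i p q
  edgeOff-injective zero zero eq = refl ,
    combine-injective _ _ _ _ (↑ʳ-injective (n * N) _ _ (↑ʳ-injective (n * n) _ _ eq))
  edgeOff-injective (suc zero) (suc zero) eq = refl ,
    combine-injective _ _ _ _ (↑ˡ-injective (n * N) _ _ (↑ʳ-injective (n * n) _ _ eq))
  edgeOff-injective (suc (suc zero)) (suc (suc zero)) eq = refl ,
    combine-injective _ _ _ _ (↑ˡ-injective (n * N + n * N) _ _ eq)
  edgeOff-injective zero (suc zero)             eq = ⊥-elim (edge₁₃≢edge₂₃ (sym eq))
  edgeOff-injective zero (suc (suc zero))       eq = ⊥-elim (edge₁₂≢edge₂₃ (sym eq))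
  edgeOff-injective (suc zero) zero             eq = ⊥-elim (edge₁₃≢edge₂₃ eq)
  edgeOff-injective (suc zero) (suc (suc zero)) eq = ⊥-elim (edge₁₂≢edge₁₃ (sym eq))
  edgeOff-injective (suc (suc zero)) zero       eq = ⊥-elim (edge₁₂≢edge₂₃ eq)
  edgeOff-injective (suc (suc zero)) (suc zero) eq = ⊥-elim (edge₁₂≢edge₁₃ eq)

  sharedEdge⇒agreeOff : ∀ {e p q} → IsEdgeOf e p → IsEdgeOf e q → ∃ λ i → AgreeOff i p q
  sharedEdge⇒agreeOff {p = p} {q} e∈p e∈q
    with i , eq ← isEdge⇒edgeOff {p = p} e∈p | j , eq′ ← isEdge⇒edgeOff {p = q} e∈q =
    i , proj₂ (edgeOff-injective i j {p} {q} (trans (sym eq) eq′))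

  edgeDisjoint⇒lines : ∀ {F} → PairwiseEdgeDisjoint F → LinesContainAtMostOne F
  edgeDisjoint⇒lines disjoint i p q p~q p∈F q∈F =
    -- Edge-disjointness only refutes `p ≢ q`; decidability of equality turns this into `p ≡ q`.
    decidable-stable (p ≟ₚ q) λ p≢q → disjoint p q p∈F q∈F p≢q (edgeOff i p)
      (edgeOff-isEdge i p ,
       subst (λ e → IsEdgeOf e q) (sym (agreeOff⇒edgeOff≡ i p~q)) (edgeOff-isEdge i q))

  lines⇒edgeDisjoint : ∀ {F} → LinesContainAtMostOne F → PairwiseEdgeDisjoint F
  lines⇒edgeDisjoint lines p q p∈F q∈F p≢q e (e∈p , e∈q)
    with i , p~q ← sharedEdge⇒agreeOff {e} {p} {q} e∈p e∈q = p≢q (lines i p q p~q p∈F q∈F)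

  shadow⇒union : ∀ {F} i p → Shadow i F p → UnionGraph F (edgeOff i p)
  shadow⇒union i p (q , q∈F , q~p) =
    q , q∈F , subst (λ e → IsEdgeOf e q) (agreeOff⇒edgeOff≡ i q~p) (edgeOff-isEdge i q)

  union⇒shadow : ∀ {F} i p → UnionGraph F (edgeOff i p) → Shadow i F p
  union⇒shadow i p (q , q∈F , e∈q) with j , eq ← isEdge⇒edgeOff {p = q} e∈q
    -- The edge of `q` must lie in the same block as that of `p`, which forces `j` to be `i`.
    with refl , p~q ← edgeOff-injective i j {p} {q} eq = q , q∈F , agreeOff-sym i p~q

  shadowClosed⇒noNewTriangle : ∀ {F} → ShadowClosed F →
                               ∀ p → IsTriangleIn (UnionGraph F) p → p ∈ F
  shadowClosed⇒noNewTriangle {F} closed p (e₁₂ , e₁₃ , e₂₃) = closed p shadows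
    where
    shadows : ∀ i → Shadow i F p
    shadows zero             = union⇒shadow zero p e₂₃
    shadows (suc zero)       = union⇒shadow (suc zero) p e₁₃
    shadows (suc (suc zero)) = union⇒shadow (suc (suc zero)) p e₁₂

  noNewTriangle⇒shadowClosed : ∀ {F} → (∀ p → IsTriangleIn (UnionGraph F) p → p ∈ F) →
                               ShadowClosed F
  noNewTriangle⇒shadowClosed noNew p shadow = noNew p
    ( shadow⇒union (suc (suc zero)) p (shadow (suc (suc zero)))
    , shadow⇒union (suc zero) p (shadow (suc zero))
    , shadow⇒union zero p (shadow zero))

  cylinderIntersection⇒admissible : ∀ {f S} → LinesContainAtMostOne f → S ⊆ f →
                                    IsCylinderIntersection S → IsAdmissible ⊤ S
  cylinderIntersection⇒admissible lines S⊆f cyl =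
    -- The host graph is complete, so every triple is a triangle in it.
    (λ _ _ → ∈⊤ , ∈⊤ , ∈⊤) ,
    lines⇒edgeDisjoint (λ i p q p~q p∈S q∈S → lines i p q p~q (S⊆f p∈S) (S⊆f q∈S)) ,
    shadowClosed⇒noNewTriangle (cylinderIntersection⇒shadowClosed cyl)

  -- Partial matrices and insertion of a value

  Filled : Points → Fin n × Fin n → Set
  Filled F (x , y) = ∃ λ b → (x , y , b) ∈ F

  insert-lines : ∀ {F} p → LinesContainAtMostOne F →
                 (∀ i q → q ∈ F → ¬ AgreeOff i q p) → LinesContainAtMostOne (F ∪ ⁅ index p ⁆)
  insert-lines {F} p lines free i q r q~r q∈ r∈
    with x∈p∪q⁻ F ⁅ index p ⁆ q∈ | x∈p∪q⁻ F ⁅ index p ⁆ r∈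
  ... | inj₁ q∈F | inj₁ r∈F = lines i q r q~r q∈F r∈F
  ... | inj₁ q∈F | inj₂ r∈p with refl ← index-injective {r} {p} (x∈⁅y⁆⇒x≡y (index p) r∈p) =
    ⊥-elim (free i q q∈F q~r)
  ... | inj₂ q∈p | inj₁ r∈F with refl ← index-injective {q} {p} (x∈⁅y⁆⇒x≡y (index p) q∈p) =
    ⊥-elim (free i r r∈F (agreeOff-sym i q~r))
  ... | inj₂ q∈p | inj₂ r∈p =
    index-injective (trans (x∈⁅y⁆⇒x≡y _ q∈p) (sym (x∈⁅y⁆⇒x≡y _ r∈p)))

  Extension : Points → Pred Points 0ℓ
  Extension F F′ = F ⊆ F′ × LinesContainAtMostOne F′

  lines+filled⇒linjection : ∀ {F} → LinesContainAtMostOne F → (∀ c → Filled F c) → IsLinjection F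
  lines+filled⇒linjection lines filled =
    (λ x y → let b , b∈ = filled (x , y) in
       b , b∈ , λ {b′} b′∈ →
         cong (proj₂ ∘ proj₂) (lines (suc (suc zero)) (x , y , b) (x , y , b′) (refl , refl) b∈ b′∈)) ,
    lines

-- Greedy completion to a linjection

module _ {m N : ℕ} (2m<N : suc (m + m) ≤ N) where
  open Box (suc m) N
  open BoxProperties (suc m) N

  Blocked : Points → Fin (suc m) → Fin (suc m) → Pred (Fin N) 0ℓ
  Blocked F x y b = (∃ λ x′ → (x′ , y , b) ∈ F) ⊎ (∃ λ y′ → (x , y′ , b) ∈ F)

  blocked? : ∀ F x y → Decidable (Blocked F x y)
  blocked? F x y b = any? (λ x′ → (x′ , y , b) ∈? F) ⊎-dec any? (λ y′ → (x , y′ , b) ∈? F)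

  -- The `m` other cells of the row and the `m` other cells of the column hold at most one value
  -- each, so at most `m + m < N` values are blocked.
  freeValue : ∀ {F} → LinesContainAtMostOne F → ∀ x y → ¬ Filled F (x , y) →
              ∃ λ b → ∀ i q → q ∈ F → ¬ AgreeOff i q (x , y , b)
  freeValue {F} lines x y empty with any? (λ b → ¬? (blocked? F x y b))
  ... | yes (b , ¬blocked) = b , free
    where
    free : ∀ i q → q ∈ F → ¬ AgreeOff i q (x , y , b)
    free zero             (x′ , _ , _) q∈F (refl , refl) = ¬blocked (inj₁ (x′ , q∈F))
    free (suc zero)       (_ , y′ , _) q∈F (refl , refl) = ¬blocked (inj₂ (y′ , q∈F))
    -- The third line is the cell itself, which is empty.
    free (suc (suc zero)) (_ , _ , b′) q∈F (refl , refl) = empty (b′ , q∈F)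
  ... | no allBlocked = ⊥-elim (<-irrefl refl (≤-trans 2m<N
    -- `x` and `y` are the omitted indices: both stand for the empty cell, which blocks nothing.
    -- This saves one index on each side and gives `N ≤ m + m`.
    (covered⇒≤ {R = λ x′ b → (x′ , y , b) ∈ F} {S = λ y′ b → (x , y′ , b) ∈ F} x y
       (λ b b∈ → empty (b , b∈)) (λ b b∈ → empty (b , b∈))
       (λ {x′} → sameValue x′ y) (λ {y′} → sameValue x y′)
       (λ b → decidable-stable (blocked? F x y b) (λ ¬blocked → allBlocked (b , ¬blocked))))))
    where
    sameValue : ∀ x y {b b′} → (x , y , b) ∈ F → (x , y , b′) ∈ F → b ≡ b′
    sameValue x y {b} {b′} b∈ b′∈ = cong (proj₂ ∘ proj₂)
      (lines (suc (suc zero)) (x , y , b) (x , y , b′) (refl , refl) b∈ b′∈)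

  fillCell : ∀ {F} → LinesContainAtMostOne F → ∀ c → ∃ λ F′ → Extension F F′ × Filled F′ c
  fillCell {F} lines (x , y) with any? (λ b → (x , y , b) ∈? F)
  ... | yes filled = F , ((λ i∈ → i∈) , lines) , filled
  ... | no empty with b , free ← freeValue lines x y empty =
    F ∪ ⁅ index (x , y , b) ⁆ ,
    (p⊆p∪q _ , insert-lines (x , y , b) lines free) ,
    b , q⊆p∪q F _ (x∈⁅x⁆ _)

  fillCells : ∀ {F} → LinesContainAtMostOne F → ∀ cs → ∃ λ F′ → Extension F F′ × All (Filled F′) cs
  fillCells {F} lines [] = F , ((λ i∈ → i∈) , lines) , []
  fillCells lines (c ∷ cs)
    with F₁ , (F⊆F₁ , lines₁) , b , b∈F₁ ← fillCell lines c
    with F₂ , (F₁⊆F₂ , lines₂) , filled ← fillCells lines₁ cs =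
    -- Points are only ever added, so a cell filled earlier stays filled.
    F₂ , ((λ i∈ → F₁⊆F₂ (F⊆F₁ i∈)) , lines₂) , (b , F₁⊆F₂ b∈F₁) ∷ filled

  extendToLinjection : ∀ {F} → LinesContainAtMostOne F → ∃ λ f → IsLinjection f × F ⊆ f
  extendToLinjection lines
    with f , (F⊆f , lines′) , filled ←
      fillCells lines (cartesianProduct (allFin (suc m)) (allFin (suc m))) =
    f , lines+filled⇒linjection lines′
          (λ (x , y) → lookup filled (∈-cartesianProduct⁺ (∈-allFin x) (∈-allFin y))) ,
    F⊆f

  -- Comparison of the two maxima

  ᾱ≤α₃ : ᾱ (suc m) N ≤ α₃ (suc m) N
  ᾱ≤α₃ = maxOver-least (λ _ → yes tt) ᾱ-of λ G _ → maxOver-least (isAdmissible? G) _ bound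
    where
    bound : ∀ {G} F → IsAdmissible G F → _
    bound F (_ , disjoint , noNew)
      -- Completing the matrix leaves `F` itself unchanged: being a cylinder intersection does not
      -- depend on `f`, so `F` is counted at full size in `α₃-of f`.
      with f , linj , F⊆f ← extendToLinjection (edgeDisjoint⇒lines disjoint) =
      ≤-trans
        (maxOver-upper (λ S → isCylinderIntersection? S ×-dec S ⊆? f) _
          (shadowClosed⇒cylinderIntersection (noNewTriangle⇒shadowClosed noNew) , F⊆f))
        (maxOver-upper isLinjection? α₃-of linj)

α₃≤ᾱ : ∀ n N → α₃ n N ≤ ᾱ n N
α₃≤ᾱ n N = maxOver-least isLinjection? α₃-of λ f (_ , lines) →
  maxOver-least (λ S → isCylinderIntersection? S ×-dec S ⊆? f) _ λ S (cyl , S⊆f) →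
    ≤-trans (maxOver-upper (isAdmissible? ⊤) _ (cylinderIntersection⇒admissible lines S⊆f cyl))
            (maxOver-upper (λ _ → yes tt) ᾱ-of tt)
  where
  open Box n N
  open BoxProperties n N

theorem14 : (n N : ℕ) → n > 0 → N > 0 →
    (n ≤ N → α₃ n N ≤ ᾱ n N) ×
    (N ≥ 2 * n ∸ 1 → α₃ n N ≡ ᾱ n N)
theorem14 n@(suc m) N _ _ =
  (λ _ → α₃≤ᾱ n N) ,
  λ N≥2n-1 → ≤-antisym (α₃≤ᾱ n N)
    -- For `n = suc m`, `2 * n ∸ 1` computes to `m + suc (m + 0)`, which is rewritten to
    -- `suc (m + m)`.
    (ᾱ≤α₃ (subst (_≤ N) (trans (+-suc m (m + 0)) (cong (λ k → suc (m + k)) (+-identityʳ m))) N≥2n-1))
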